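{- Let $d\ge1$, $P\subseteq\mathbb R\times[d]$ and $k\in[d]$. The fractional Helly number of $(P,\mathcal C_{\equiv}(P))$ with respect to $k$-intersecting satisfies $h_{fk}(P,\mathcal C_{\equiv}(P))\le 2d-k+1$.
   Context: $[d]=\{1,\dots,d\}$. A (separated) $d$-interval is a set $I=\bigcup_{i\in[d]}\{(x,i): x\in I^{(i)}\}\subseteq\mathbb R\times[d]$ with each $I^{(i)}\subseteq\mathbb R$ convex (possibly empty); points $(x,i)$ lie in the $i$-th level. For $P\subseteq\mathbb R\times[d]$, $\mathcal C_{\equiv}(P)=\{I\cap P: I \text{ a } d\text{ -interval}\}$. A collection of sets of $\mathcal C_{\equiv}(P)$ $k$-intersects (is $k$-intersecting) if its intersection contains at least $k$ points of $P$ lying in $k$ distinct levels. $h_{fk}(P,\mathcal C_{\equiv}(P))$ is the minimal integer $m$ such that there is a function $\beta:(0,1)\to(0,1)$ with the property: every finite $\mathcal F\subseteq\mathcal C_{\equiv}(P)$ having at least $\alpha\binom{|\mathcal F|}{m}$ $k$-intersecting $m$-element subfamilies contains a $k$-intersecting subfamily of size at least $\beta(\alpha)|\mathcal F|$.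
   Formalization: In the definition of the fractional Helly number only families with |F| ≥ m are considered; otherwise the binomial coefficient is 0 and the family consisting of the empty set alone refutes the property for every m ≥ 2. -}

module Defs where

open import Data.Fin.Base using (Fin)
import Data.Fin.Subset as Sub
open import Data.Integer.Base using (+_)
open import Data.List.Base using (List; length)
open import Data.List.Relation.Unary.All using (All)
open import Data.List.Relation.Unary.Unique.Propositional using (Unique)
open import Data.Nat.Base as ℕ using (ℕ)
open import Data.Nat.Combinatorics using (_C_)
open import Data.Product.Base using (Σ; ∃-syntax; _×_; _,_; proj₁; proj₂)
open import Data.Product.Relation.Binary.Pointwise.NonDependent using (Pointwise)
open import Data.Rational.Base as ℚ using (ℚ; 0ℚ; 1ℚ)
import Data.Rational.Properties as ℚₚ
open import Function.Base using (_∘_)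
open import Function.Definitions using (Congruent; Injective)
open import Level using (0ℓ)
open import Relation.Binary.Core using (Rel)
open import Relation.Binary.PropositionalEquality.Core using (_≡_; refl; subst)
open import Relation.Unary using (Pred; _∈_; _∉_; _⊆_; _≐_; _∩_)

-- One-sided Dedekind cuts. Under excluded middle, which the main statement
-- assumes, these are the classical real numbers.

record ℝ : Set₁ where
  field
    Lower     : Pred ℚ 0ℓ
    inhabited : ∃[ q ] q ∈ Lower
    bounded   : ∃[ q ] q ∉ Lower
    down      : ∀ {p q} → p ℚ.< q → q ∈ Lower → p ∈ Lower
    open′     : ∀ {p} → p ∈ Lower → ∃[ q ] p ℚ.< q × q ∈ Lower

open ℝ public

infix 4 _≤_ _<_ _≈_

_≤_ _<_ _≈_ : Rel ℝ 0ℓ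
x ≤ y = Lower x ⊆ Lower y
x < y = ∃[ q ] q ∈ Lower y × q ∉ Lower x
x ≈ y = x ≤ y × y ≤ x

private
  q-1<q : ∀ q → q ℚ.- 1ℚ ℚ.< q
  q-1<q q = subst (q ℚ.- 1ℚ ℚ.<_) (ℚₚ.+-identityʳ q)
              (ℚₚ.+-monoʳ-< q (ℚₚ.negative⁻¹ (ℚ.- 1ℚ)))

fromℚ : ℚ → ℝ
fromℚ r = record
  { Lower     = ℚ._< r
  ; inhabited = r ℚ.- 1ℚ , q-1<q r
  ; bounded   = r , ℚₚ.<-irrefl refl
  ; down      = ℚₚ.<-trans
  ; open′     = ℚₚ.<-dense
  }

ℕ→ℚ : ℕ → ℚ
ℕ→ℚ n = + n ℚ./ 1

fromℕ : ℕ → ℝ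
fromℕ = fromℚ ∘ ℕ→ℚ

infixl 7 _•_

-- The product n · x in ℝ. Its lower cut is given by strict bounds q < n · r
-- with r < x, so that n = 0 needs no special case.
_•_ : ℕ → ℝ → ℝ
n • x = record
  { Lower     = λ q → ∃[ r ] r ∈ Lower x × q ℚ.< ℕ→ℚ n ℚ.* r
  ; inhabited = let r , r∈x = inhabited x in
                _ , r , r∈x , q-1<q (ℕ→ℚ n ℚ.* r)
  ; bounded   = let u , u∉x = bounded x in
                ℕ→ℚ n ℚ.* u , λ (r , r∈x , nu<nr) →
                  ℚₚ.<-irrefl refl (ℚₚ.<-≤-trans nu<nr
                    (ℚₚ.*-monoˡ-≤-nonNeg (ℕ→ℚ n) {{ℚₚ.normalize-nonNeg n 1}}
                      (ℚₚ.≮⇒≥ λ u<r → u∉x (down x u<r r∈x))))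
  ; down      = λ p<q (r , r∈x , q<nr) → r , r∈x , ℚₚ.<-trans p<q q<nr
  ; open′     = λ (r , r∈x , p<nr) → let m , p<m , m<nr = ℚₚ.<-dense p<nr in
                m , p<m , r , r∈x , m<nr
  }

UnitInterval : Set₁
UnitInterval = Σ ℝ λ x → fromℚ 0ℚ < x × x < fromℚ 1ℚ

_≈ᵤ_ : Rel UnitInterval 0ℓ
α ≈ᵤ β = proj₁ α ≈ proj₁ β

Convex : Pred (Pred ℝ 0ℓ) _
Convex A = ∀ {x y z} → x ∈ A → z ∈ A → x ≤ y → y ≤ z → y ∈ A

-- Fin d plays the role of [d].
Point : ℕ → Set₁
Point d = ℝ × Fin d

level : ∀ {d} → Point d → Fin d
level = proj₂

_≈ₚ_ : ∀ {d} → Rel (Point d) 0ℓ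
_≈ₚ_ = Pointwise _≈_ _≡_

record Interval (d : ℕ) : Set₁ where
  field
    part   : Fin d → Pred ℝ 0ℓ
    convex : ∀ i → Convex (part i)

  points : Pred (Point d) 0ℓ
  points (x , i) = x ∈ part i

open Interval public using (points)

𝒞 : ∀ {d} → Pred (Point d) 0ℓ → Pred (Pred (Point d) 0ℓ) _
𝒞 {d} P S = Σ (Interval d) λ I → S ≐ points I ∩ P

-- Finite families are enumerated as F : Fin n → Pred (Point d) 0ℓ, and a
-- subfamily is given by the set G of its indices.

Intersecting : ∀ {d n} → ℕ → Pred (Point d) 0ℓ → (Fin n → Pred (Point d) 0ℓ) →
               Sub.Subset n → Set₁
Intersecting {d} k P F G =
  Σ (Fin k → Point d) λ p →
    (∀ a → p a ∈ P) ×
    (∀ a j → j Sub.∈ G → p a ∈ F j) ×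
    Injective _≡_ _≡_ (level ∘ p)

-- F has at least y k-intersecting m-element subfamilies.
ManyIntersecting : ∀ {d n} → ℕ → Pred (Point d) 0ℓ → (Fin n → Pred (Point d) 0ℓ) →
                   ℕ → ℝ → Set₁
ManyIntersecting {n = n} k P F m y =
  Σ (List (Sub.Subset n)) λ Gs →
    Unique Gs ×
    All (λ G → Sub.∣ G ∣ ≡ m × Intersecting k P F G) Gs ×
    y ≤ fromℕ (length Gs)

-- As usual for fractional Helly properties, only families of at least m sets
-- are considered: for n < m the binomial coefficient vanishes, and then the
-- family consisting of the empty set alone would refute the property for
-- every m ≥ 2.
FractionalHelly : ∀ {d} → ℕ → Pred (Point d) 0ℓ → ℕ → Set₁
FractionalHelly {d} k P m =
  Σ (UnitInterval → UnitInterval) λ β →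
    Congruent _≈ᵤ_ _≈ᵤ_ β ×
    (∀ (α : UnitInterval) (n : ℕ) (F : Fin n → Pred (Point d) 0ℓ) →
       (∀ j → F j ∈ 𝒞 P) →
       Injective _≡_ _≐_ F →
       m ℕ.≤ n →
       ManyIntersecting k P F m ((n C m) • proj₁ α) →
       ∃[ G ] Intersecting k P F G × n • proj₁ (β α) ≤ fromℕ Sub.∣ G ∣)

IsFractionalHellyNumber : ∀ {d} → ℕ → Pred (Point d) 0ℓ → ℕ → Set₁
IsFractionalHellyNumber k P h =
  FractionalHelly k P h × (∀ m → FractionalHelly k P m → h ℕ.≤ m)

{-# OPTIONS --safe #-}
module Submission where

-- Already m = k + 1 works, and k + 1 ≤ 2d − k + 1. Let G consist of k + 1 sets
-- sharing points on k distinct levels. On each of these levels some member of G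
-- starts last; as G has k + 1 members, one of them, the spare set b, is not
-- needed for this. There are at most dᵏ · C(n,k) keys (levels, G − b), so many
-- of the G share a key. For each level of that key take the leftmost of the
-- points chosen for those G. It lies to the right of the start of every spare
-- set and weakly to the left of a point of that set, hence in the set. So all
-- these spare sets k-intersect, and they are distinct because G − b is fixed.

open import Axiom.ExcludedMiddle using (ExcludedMiddle)
open import Data.Bool.Base using (true; false)
import Data.Bool.Properties as Bool
open import Data.Empty using (⊥-elim)
open import Data.Fin.Base using (Fin; zero; suc; funToFin; finToFun)
import Data.Fin.Properties as Fin
open import Data.Fin.Subset as Sub using (Subset; inside; outside; ∣_∣; _-_)
import Data.Fin.Subset.Properties as Subₚ
open import Data.Integer.Base as ℤ using (+_)
import Data.Integer.Properties as ℤ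
open import Data.List.Base
  using (List; []; _∷_; length; map; filter; _++_; allFin; cartesianProduct)
import Data.List.Extrema.Nat as Extrema
open import Data.List.Membership.Propositional using () renaming (_∈_ to _∈ₗ_)
import Data.List.Membership.Propositional.Properties as Membership
import Data.List.Properties as List
import Data.List.Relation.Binary.Sublist.Propositional.Properties as Sublist
open import Data.List.Relation.Unary.All as All using (All; []; _∷_)
import Data.List.Relation.Unary.All.Properties as All
open import Data.List.Relation.Unary.AllPairs using (AllPairs; []; _∷_)
import Data.List.Relation.Unary.AllPairs.Properties as AllPairs
open import Data.List.Relation.Unary.Any using (here; there)
open import Data.List.Relation.Unary.Unique.Propositional using (Unique)
open import Data.Nat.Base as ℕ
  using (ℕ; zero; suc; _≤_; _<_; _+_; _*_; _^_; _∸_; z≤n; s≤s)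
open import Data.Nat.Combinatorics
  using (_C_; nCk+nC[k+1]≡[n+1]C[k+1]; nCk≡nC[n∸k]; nCn≡1; nC1≡n)
import Data.Nat.Coprimality as Coprimality
open import Data.Nat.Induction using (<-rec)
import Data.Nat.Properties as ℕ
open import Data.Nat.Tactic.RingSolver using (solve-∀)
open import Data.Product.Base using (∃; ∃-syntax; _×_; _,_; proj₁; proj₂)
open import Data.Product.Properties using (≡-dec; ,-injectiveˡ; ,-injectiveʳ)
open import Data.Rational.Base as ℚ using (ℚ; mkℚ; 1ℚ)
import Data.Rational.Properties as ℚ
open import Data.Sum.Base using (inj₁; inj₂; reduce)
open import Data.Vec.Base using ([]; _∷_; tabulate)
import Data.Vec.Properties as Vec
open import Function.Base using (_∘_; _on_; id; case_of_)
open import Function.Definitions using (Injective)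
open import Level using (Level; 0ℓ; Lift; lift; lower) renaming (suc to lsuc)
open import Relation.Binary.Core using (Rel)
open import Relation.Binary.Definitions
  using (_Respects_; DecidableEquality; Total; Transitive; tri<; tri≈; tri>)
open import Relation.Binary.PropositionalEquality
  using (_≡_; _≢_; refl; sym; trans; cong; cong₂; subst; subst₂; module ≡-Reasoning)
open import Relation.Nullary using (Dec; does; yes; no; contradiction)
open import Relation.Nullary.Decidable as Dec using (dec-true; decidable-stable)
open import Relation.Unary using (Pred; Decidable; _∈_; _∉_)
open import Relation.Unary.Properties using (∁?)

open import Defs renaming (_≤_ to _≤ᴿ_) hiding (_<_; _≈_)

private variable
  a ℓ : Level
  A B : Set a
  d k n : ℕ

-- Fibres and greatest elements in lists.

length-filter-∁ : {P : Pred A ℓ} (P? : Decidable P) (xs : List A) →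
  length (filter P? xs) + length (filter (∁? P?) xs) ≡ length xs
length-filter-∁ P? []       = refl
length-filter-∁ P? (x ∷ xs) with does (P? x)
... | true  = cong suc (length-filter-∁ P? xs)
... | false = trans (ℕ.+-suc _ _) (cong suc (length-filter-∁ P? xs))

module _ (_≟_ : DecidableEquality B) (f : A → B) where

  fibre : B → List A → List A
  fibre κ = filter (λ x → f x ≟ κ)

  -- Induction on `ks`: once the fibre of the first value is removed, the remaining elements take
  -- values in the rest of the list, and no other fibre has grown.
  length≤fibres : ∀ t (ks : List B) (xs : List A) → All (λ x → f x ∈ₗ ks) xs →
    All (λ κ → length (fibre κ xs) ≤ t) ks → length xs ≤ length ks * t
  length≤fibres t []       []      _        _        = z≤n
  length≤fibres t []       (_ ∷ _) (() ∷ _) _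
  length≤fibres t (κ ∷ ks) xs      fxs∈ (fκ≤t ∷ f≤t) = begin
    length xs                              ≡⟨ length-filter-∁ κ? xs ⟨
    length (fibre κ xs) + length others    ≤⟨ ℕ.+-mono-≤ fκ≤t others≤ ⟩
    t + length ks * t                      ∎
    where
    open ℕ.≤-Reasoning
    κ? = λ x → f x ≟ κ
    others = filter (∁? κ?) xs
    others∈ : All (λ x → f x ∈ₗ ks) others
    others∈ = All.zipWith (λ { (here eq , fx≢κ) → contradiction eq fx≢κ ; (there fx∈ , _) → fx∈ })
                (All.filter⁺ (∁? κ?) fxs∈ , All.all-filter (∁? κ?) xs)
    shrink : ∀ {κ′} → length (fibre κ′ xs) ≤ t → length (fibre κ′ others) ≤ t
    shrink {κ′} = ℕ.≤-trans (Sublist.length-mono-≤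
      (Sublist.filter⁺ (λ x → f x ≟ κ′) (λ x → f x ≟ κ′) (λ { refl p → p })
        (Sublist.filter-⊆ (∁? κ?) xs)))
    others≤ = length≤fibres t ks others others∈ (All.map shrink f≤t)

  pigeonhole : (ks : List B) (xs : List A) → 0 < length xs → All (λ x → f x ∈ₗ ks) xs →
    ∃ λ κ → length xs ≤ length ks * length (fibre κ xs)
  -- `argmax` needs a default value; `f x` is at hand because `xs` is nonempty. The maximum bounds
  -- the fibre of every value in `ks`.
  pigeonhole ks xs@(x ∷ _) _ fxs∈ = Extrema.argmax size (f x) ks ,
    length≤fibres _ ks xs fxs∈ (Extrema.f[xs]≤f[argmax] {f = size} (f x) ks)
    where size = λ κ → length (fibre κ xs)

-- Serves twice: for the set that starts last on a level and, with the order reversed, for the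
-- leftmost point. Totality supplies reflexivity through `reduce`.
greatest : {R : Rel A ℓ} → Total R → Transitive R → ∀ x xs →
  ∃ λ m → m ∈ₗ (x ∷ xs) × All (λ y → R y m) (x ∷ xs)
greatest total tr x [] = x , here refl , reduce (total x x) ∷ []
greatest total tr x (y ∷ ys) with greatest total tr y ys
... | m , m∈ , ≤m with total x m
...   | inj₁ x≤m = m , there m∈ , x≤m ∷ ≤m
...   | inj₂ m≤x = x , here refl , reduce (total x x) ∷ All.map (λ y≤m → tr y≤m m≤x) ≤m

-- Removing elements from finite subsets.

x∉p-x : ∀ (p : Subset n) x → x Sub.∉ p - x
-- Removing `x` twice equals removing it once, yet removing a member lowers the cardinality.
x∉p-x p x x∈ = ℕ.<-irrefl (cong ∣_∣ (Subₚ.p─q─q≡p─q p Sub.⁅ x ⁆)) (Subₚ.x∈p⇒∣p-x∣<∣p∣ x∈)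

∣p∣≤1+∣p-x∣ : ∀ (p : Subset n) x → ∣ p ∣ ≤ suc ∣ p - x ∣
∣p∣≤1+∣p-x∣ (inside  ∷ p) zero = s≤s (ℕ.≤-reflexive (cong ∣_∣ (sym (Subₚ.p─⊥≡p p))))
∣p∣≤1+∣p-x∣ (outside ∷ p) zero = ℕ.m≤n⇒m≤1+n (ℕ.≤-reflexive (cong ∣_∣ (sym (Subₚ.p─⊥≡p p))))
∣p∣≤1+∣p-x∣ (inside  ∷ p) (suc x) = s≤s (∣p∣≤1+∣p-x∣ p x)
∣p∣≤1+∣p-x∣ (outside ∷ p) (suc x) = ∣p∣≤1+∣p-x∣ p x

∣p-x∣≡k : ∀ {p : Subset n} {x} → x Sub.∈ p → ∣ p ∣ ≡ suc k → ∣ p - x ∣ ≡ k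
∣p-x∣≡k {p = p} {x} x∈p eq = ℕ.≤-antisym
  (ℕ.s≤s⁻¹ (subst (∣ p - x ∣ <_) eq (Subₚ.x∈p⇒∣p-x∣<∣p∣ x∈p)))
  (ℕ.s≤s⁻¹ (subst (_≤ suc ∣ p - x ∣) eq (∣p∣≤1+∣p-x∣ p x)))

p-x-injective : ∀ {p q : Subset n} {x} → x Sub.∈ p → x Sub.∈ q → p - x ≡ q - x → p ≡ q
p-x-injective x∈p x∈q eq = Subₚ.⊆-antisym (half x∈q eq) (half x∈p (sym eq))
  where
  half : ∀ {p q : Subset n} {x} → x Sub.∈ q → p - x ≡ q - x → p Sub.⊆ q
  half {q = q} {x} x∈q eq {y} y∈p with y Fin.≟ x
  ... | yes refl = x∈q
  ... | no  y≢x  = Subₚ.p─q⊆p q Sub.⁅ x ⁆ (subst (y Sub.∈_) eq (Subₚ.x∈p∧x≢y⇒x∈p-y y∈p y≢x))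

-- Deleting the values of `f` one by one costs at most one member each, so a member survives.
-- Applied to last starters, this yields the spare set.
outside-image : ∀ {k n} (p : Subset n) (f : Fin k → Fin n) → k < ∣ p ∣ →
  ∃ λ x → x Sub.∈ p × ∀ a → f a ≢ x
outside-image {k = zero} {n} p f 0<∣p∣ with Subₚ.nonempty? p
... | yes (x , x∈p) = x , x∈p , λ ()
... | no  empty     = contradiction
  (trans (cong ∣_∣ (Subₚ.Empty-unique empty)) (Subₚ.∣⊥∣≡0 n)) (ℕ.>⇒≢ 0<∣p∣)
outside-image {k = suc k} p f k<∣p∣
  with outside-image (p - f zero) (f ∘ suc) (ℕ.s≤s⁻¹ (ℕ.≤-trans k<∣p∣ (∣p∣≤1+∣p-x∣ p (f zero))))
... | x , x∈ , f≢x = x , Subₚ.p─q⊆p p Sub.⁅ f zero ⁆ x∈ , λ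
  { zero refl → x∉p-x p _ x∈ ; (suc a) → f≢x a }

length≤∣p∣ : ∀ {xs} (p : Subset n) → Unique xs → All (Sub._∈ p) xs → length xs ≤ ∣ p ∣
length≤∣p∣ p []          []           = z≤n
length≤∣p∣ p (x∉xs ∷ xs!) (x∈p ∷ xs⊆p) = ℕ.≤-trans
  (s≤s (length≤∣p∣ (p - _) xs! (All.zipWith
    (λ (x≢y , y∈p) → Subₚ.x∈p∧x≢y⇒x∈p-y y∈p (x≢y ∘ sym)) (x∉xs , xs⊆p))))
  (Subₚ.x∈p⇒∣p-x∣<∣p∣ x∈p)

-- Subsets of fixed size and binomial coefficients.

subsetsOfSize : ∀ n → ℕ → List (Subset n)
subsetsOfSize n       zero    = Sub.⊥ ∷ []
subsetsOfSize zero    (suc k) = []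
subsetsOfSize (suc n) (suc k) =
  map (inside ∷_) (subsetsOfSize n k) ++ map (outside ∷_) (subsetsOfSize n (suc k))

length-subsetsOfSize : ∀ n k → length (subsetsOfSize n k) ≡ n C k
length-subsetsOfSize zero    zero    = refl
length-subsetsOfSize (suc n) zero    = sym (trans (nCk≡nC[n∸k] {0} {suc n} z≤n) (nCn≡1 (suc n)))
length-subsetsOfSize zero    (suc k) = refl
length-subsetsOfSize (suc n) (suc k) = begin
  length (map (inside ∷_) (subsetsOfSize n k) ++ map (outside ∷_) (subsetsOfSize n (suc k)))
    ≡⟨ List.length-++ (map (inside ∷_) (subsetsOfSize n k)) ⟩
  length (map (inside ∷_) (subsetsOfSize n k)) + length (map (outside ∷_) (subsetsOfSize n (suc k)))
    ≡⟨ cong₂ _+_ (trans (List.length-map _ (subsetsOfSize n k)) (length-subsetsOfSize n k))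
                 (trans (List.length-map _ (subsetsOfSize n (suc k))) (length-subsetsOfSize n (suc k))) ⟩
  n C k + n C suc k
    ≡⟨ nCk+nC[k+1]≡[n+1]C[k+1] n k ⟩
  suc n C suc k ∎
  where open ≡-Reasoning

∈-subsetsOfSize : ∀ k (p : Subset n) → ∣ p ∣ ≡ k → p ∈ₗ subsetsOfSize n k
∈-subsetsOfSize zero    []            _    = here refl
∈-subsetsOfSize zero    (outside ∷ p) eq with ∈-subsetsOfSize zero p eq
... | here refl = here refl
∈-subsetsOfSize (suc k) (inside  ∷ p) eq = Membership.∈-++⁺ˡ
  (Membership.∈-map⁺ (inside ∷_) (∈-subsetsOfSize k p (ℕ.suc-injective eq)))
∈-subsetsOfSize {n = suc n} (suc k) (outside ∷ p) eq = Membership.∈-++⁺ʳ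
  (map (inside ∷_) (subsetsOfSize n k))
  (Membership.∈-map⁺ (outside ∷_) (∈-subsetsOfSize (suc k) p eq))

-- The absorption identity (k+1)·C(n,k+1) = (n-k)·C(n,k), with the subtraction moved across to stay
-- within ℕ.
[k+1]nC[k+1]+k*nCk≡n*nCk : ∀ n k → suc k * (n C suc k) + k * (n C k) ≡ n * (n C k)
[k+1]nC[k+1]+k*nCk≡n*nCk zero    zero    = refl
[k+1]nC[k+1]+k*nCk≡n*nCk zero    (suc k) = trans (cong₂ _+_ (ℕ.*-zeroʳ k) (ℕ.*-zeroʳ k)) refl
[k+1]nC[k+1]+k*nCk≡n*nCk (suc n) zero    = begin
  (suc n C 1 + 0) + 0   ≡⟨ trans (ℕ.+-identityʳ _) (ℕ.+-identityʳ _) ⟩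
  suc n C 1             ≡⟨ nC1≡n (suc n) ⟩
  suc n                 ≡⟨ ℕ.*-identityʳ (suc n) ⟨
  -- At size zero `length-subsetsOfSize` says 1 = C(n+1,0).
  suc n * 1             ≡⟨ cong (suc n *_) (length-subsetsOfSize (suc n) zero) ⟩
  suc n * (suc n C 0)   ∎
  where open ≡-Reasoning
[k+1]nC[k+1]+k*nCk≡n*nCk (suc n) (suc k) = begin
  suc (suc k) * (suc n C suc (suc k)) + suc k * (suc n C suc k)
    ≡⟨ cong₂ (λ x y → suc (suc k) * x + suc k * y)
         (nCk+nC[k+1]≡[n+1]C[k+1] n (suc k)) (nCk+nC[k+1]≡[n+1]C[k+1] n k) ⟨
  suc (suc k) * (c₁ + c₂) + suc k * (c₀ + c₁)
    ≡⟨ regroup k c₀ c₁ c₂ ⟩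
  -- The first two brackets are the identity at k + 1 and at k; the remainder is C(n+1,k+1) by
  -- Pascal's rule.
  (suc (suc k) * c₂ + suc k * c₁) + (suc k * c₁ + k * c₀) + (c₀ + c₁)
    ≡⟨ cong (_+ (c₀ + c₁)) (cong₂ _+_ ([k+1]nC[k+1]+k*nCk≡n*nCk n (suc k)) ([k+1]nC[k+1]+k*nCk≡n*nCk n k)) ⟩
  n * c₁ + n * c₀ + (c₀ + c₁)
    ≡⟨ collect n c₀ c₁ ⟩
  suc n * (c₀ + c₁)
    ≡⟨ cong (suc n *_) (nCk+nC[k+1]≡[n+1]C[k+1] n k) ⟩
  suc n * (suc n C suc k) ∎
  where
  open ≡-Reasoning
  c₀ = n C k
  c₁ = n C suc k
  c₂ = n C suc (suc k)
  regroup : ∀ k c₀ c₁ c₂ → suc (suc k) * (c₁ + c₂) + suc k * (c₀ + c₁) ≡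
    (suc (suc k) * c₂ + suc k * c₁) + (suc k * c₁ + k * c₀) + (c₀ + c₁)
  regroup = solve-∀
  collect : ∀ n c₀ c₁ → n * c₁ + n * c₀ + (c₀ + c₁) ≡ suc n * (c₀ + c₁)
  collect = solve-∀

-- Natural numbers in ℚ and quotients of reals.

ℕ→ℚ-nonNeg : ∀ n → ℚ.NonNegative (ℕ→ℚ n)
ℕ→ℚ-nonNeg n = ℚ.normalize-nonNeg n 1

ℕ→ℚ-pos : ∀ n .{{_ : ℕ.NonZero n}} → ℚ.Positive (ℕ→ℚ n)
ℕ→ℚ-pos n = ℚ.normalize-pos n 1

-- The division in `ℕ→ℚ` normalises by a gcd that is stuck on a variable; the explicit form with
-- denominator one lets arithmetic and comparisons compute.
ℕ→ℚ≡mkℚ : ∀ n → ℕ→ℚ n ≡ mkℚ (+ n) 0 (Coprimality.sym (Coprimality.1-coprimeTo n))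
ℕ→ℚ≡mkℚ n = ℚ.normalize-coprime (Coprimality.sym (Coprimality.1-coprimeTo n))

ℕ→ℚ-+ : ∀ m n → ℕ→ℚ (m + n) ≡ ℕ→ℚ m ℚ.+ ℕ→ℚ n
ℕ→ℚ-+ m n rewrite ℕ→ℚ≡mkℚ m | ℕ→ℚ≡mkℚ n =
  cong (ℚ._/ 1) (sym (cong₂ ℤ._+_ (ℤ.*-identityʳ (+ m)) (ℤ.*-identityʳ (+ n))))

ℕ→ℚ-* : ∀ m n → ℕ→ℚ (m * n) ≡ ℕ→ℚ m ℚ.* ℕ→ℚ n
ℕ→ℚ-* m n rewrite ℕ→ℚ≡mkℚ m | ℕ→ℚ≡mkℚ n = cong (ℚ._/ 1) (ℤ.pos-* m n)

ℕ→ℚ-mono-≤ : ∀ {m n} → m ≤ n → ℕ→ℚ m ℚ.≤ ℕ→ℚ n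
ℕ→ℚ-mono-≤ {m} {n} m≤n rewrite ℕ→ℚ≡mkℚ m | ℕ→ℚ≡mkℚ n =
  ℚ.*≤* (ℤ.*-monoʳ-≤-nonNeg (+ 1) (ℤ.+≤+ m≤n))

divide : ∀ N .{{_ : ℕ.NonZero N}} r → ∃[ q ] ℕ→ℚ N ℚ.* q ≡ r
divide N r = ℚ.1/ ℕ→ℚ N ℚ.* r , (begin
  ℕ→ℚ N ℚ.* (ℚ.1/ ℕ→ℚ N ℚ.* r)   ≡⟨ ℚ.*-assoc (ℕ→ℚ N) (ℚ.1/ ℕ→ℚ N) r ⟨
  ℕ→ℚ N ℚ.* ℚ.1/ ℕ→ℚ N ℚ.* r     ≡⟨ cong (ℚ._* r) (ℚ.*-inverseʳ (ℕ→ℚ N)) ⟩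
  1ℚ ℚ.* r                       ≡⟨ ℚ.*-identityˡ r ⟩
  r                              ∎)
  where
  open ≡-Reasoning
  instance
    _ : ℚ.NonZero (ℕ→ℚ N)
    _ = ℚ.pos⇒nonZero (ℕ→ℚ N) {{ℕ→ℚ-pos N}}

-- The lower cut is the preimage under multiplication by `N`, so inclusions of cuts pass to
-- quotients directly.
_÷_ : ℝ → (N : ℕ) .{{_ : ℕ.NonZero N}} → ℝ
x ÷ N = record
  { Lower     = λ q → ℕ→ℚ N ℚ.* q ∈ Lower x
  ; inhabited = let r , r∈x = inhabited x ; q , Nq≡r = divide N r in
                q , subst (_∈ Lower x) (sym Nq≡r) r∈x
  ; bounded   = let r , r∉x = bounded x ; q , Nq≡r = divide N r in
                q , λ Nq∈x → r∉x (subst (_∈ Lower x) Nq≡r Nq∈x)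
  ; down      = λ p<q → down x (ℚ.*-monoʳ-<-pos (ℕ→ℚ N) {{ℕ→ℚ-pos N}} p<q)
  ; open′     = λ {p} Np∈x → let r , Np<r , r∈x = open′ x Np∈x ; q , Nq≡r = divide N r in
                q , ℚ.*-cancelˡ-<-nonNeg (ℕ→ℚ N) {{ℕ→ℚ-nonNeg N}} (subst (ℕ→ℚ N ℚ.* p ℚ.<_) (sym Nq≡r) Np<r)
                  , subst (_∈ Lower x) (sym Nq≡r) r∈x
  }

∈∧∉⇒< : ∀ (x : ℝ) {q u} → q ∈ Lower x → u ∉ Lower x → q ℚ.< u
∈∧∉⇒< x {q} {u} q∈x u∉x with ℚ.<-cmp q u
... | tri< q<u _ _ = q<u
... | tri≈ _ refl _ = contradiction q∈x u∉x
... | tri> _ _ u<q = contradiction (down x u<q q∈x) u∉x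

_÷ᵤ_ : UnitInterval → (N : ℕ) .{{_ : ℕ.NonZero N}} → UnitInterval
(x , (p , p∈x , p≮0) , (u , u<1 , u∉x)) ÷ᵤ N = x ÷ N ,
  (let q , Nq≡p = divide N p in q , subst (_∈ Lower x) (sym Nq≡p) p∈x ,
    λ q<0 → p≮0 (subst₂ ℚ._<_ Nq≡p (ℚ.*-zeroʳ (ℕ→ℚ N)) (ℚ.*-monoʳ-<-pos (ℕ→ℚ N) {{ℕ→ℚ-pos N}} q<0))) ,
  -- The bound `u` of x also bounds x/N: from 0 ≤ p < u follows u ≤ N·u, whereas N·u in the cut of x
  -- would give N·u < u.
  (u , u<1 , λ Nu∈x → ℚ.<-irrefl refl (ℚ.<-≤-trans (∈∧∉⇒< x Nu∈x u∉x) u≤Nu))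
  where
  instance
    u-nonNeg : ℚ.NonNegative u
    u-nonNeg = ℚ.nonNegative (ℚ.≤-trans (ℚ.≮⇒≥ p≮0) (ℚ.<⇒≤ (∈∧∉⇒< x p∈x u∉x)))
  u≤Nu : u ℚ.≤ ℕ→ℚ N ℚ.* u
  u≤Nu = subst (ℚ._≤ ℕ→ℚ N ℚ.* u) (ℚ.*-identityˡ u)
    (ℚ.*-monoʳ-≤-nonNeg u (ℕ→ℚ-mono-≤ {1} {N} (ℕ.>-nonZero⁻¹ N)))

-- The counting estimate.

nCk>0 : ∀ {n k} → k ≤ n → 0 < n C k
nCk>0 {n}     {zero}  _         = ℕ.≤-reflexive (length-subsetsOfSize n zero)
nCk>0 {suc n} {suc k} (s≤s k≤n) = ℕ.<-≤-trans (nCk>0 k≤n)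
  (ℕ.≤-trans (ℕ.m≤m+n (n C k) _) (ℕ.≤-reflexive (nCk+nC[k+1]≡[n+1]C[k+1] n k)))

-- From n·C(n,k) = (k+1)·C(n,k+1) + k·C(n,k) and s ≤ 1, the hypotheses give
-- C(n,k)·n·s ≤ (k+1)·L + k·C(n,k) ≤ C(n,k)·(2k+1)·D·t.
density-transfer : ∀ n k D t L {s} → s ℚ.≤ 1ℚ → ℕ→ℚ (n C suc k) ℚ.* s ℚ.≤ ℕ→ℚ L →
  0 < L → L ≤ D * (n C k) * t → ∀ {r} → ℕ→ℚ (suc (k + k) * D) ℚ.* r ≡ s →
  ℕ→ℚ n ℚ.* r ℚ.≤ ℕ→ℚ t
density-transfer n k D t L {s} s≤1 c₁s≤L L>0 L≤Dct {r} Nr≡s =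
  ℚ.*-cancelˡ-≤-pos (ℕ→ℚ (c * N)) {{ℕ→ℚ-pos (c * N)}} (begin
    ℕ→ℚ (c * N) ℚ.* (ℕ→ℚ n ℚ.* r)                           ≡⟨ regroup ⟩
    ℕ→ℚ (n * c) ℚ.* s                                       ≡⟨ cong (λ x → ℕ→ℚ x ℚ.* s) ([k+1]nC[k+1]+k*nCk≡n*nCk n k) ⟨
    ℕ→ℚ (suc k * c₁ + k * c) ℚ.* s                          ≡⟨ split ⟩
    ℕ→ℚ (suc k) ℚ.* (ℕ→ℚ c₁ ℚ.* s) ℚ.+ ℕ→ℚ (k * c) ℚ.* s    ≤⟨ ℚ.+-mono-≤
      (ℚ.*-monoˡ-≤-nonNeg (ℕ→ℚ (suc k)) {{ℕ→ℚ-nonNeg (suc k)}} c₁s≤L)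
      (ℚ.*-monoˡ-≤-nonNeg (ℕ→ℚ (k * c)) {{ℕ→ℚ-nonNeg (k * c)}} s≤1) ⟩
    ℕ→ℚ (suc k) ℚ.* ℕ→ℚ L ℚ.+ ℕ→ℚ (k * c) ℚ.* 1ℚ            ≡⟨ cong₂ ℚ._+_ (sym (ℕ→ℚ-* (suc k) L)) (ℚ.*-identityʳ (ℕ→ℚ (k * c))) ⟩
    ℕ→ℚ (suc k * L) ℚ.+ ℕ→ℚ (k * c)                         ≡⟨ ℕ→ℚ-+ (suc k * L) (k * c) ⟨
    ℕ→ℚ (suc k * L + k * c)                                 ≤⟨ ℕ→ℚ-mono-≤ count ⟩
    ℕ→ℚ (c * N * t)                                         ≡⟨ ℕ→ℚ-* (c * N) t ⟩
    ℕ→ℚ (c * N) ℚ.* ℕ→ℚ t                                   ∎)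
  where
  open ℚ.≤-Reasoning
  c  = n C k
  c₁ = n C suc k
  N  = suc (k + k) * D
  instance
    -- A positive `L` makes every factor of its upper bound positive. This licenses cancelling
    -- `c * N` and gives D·t ≥ 1 in `count`.
    Dct≢0 : ℕ.NonZero (D * c * t)
    Dct≢0 = ℕ.>-nonZero (ℕ.<-≤-trans L>0 L≤Dct)
    Dc≢0 : ℕ.NonZero (D * c)
    Dc≢0 = ℕ.m*n≢0⇒m≢0 (D * c)
    t≢0 : ℕ.NonZero t
    t≢0 = ℕ.m*n≢0⇒n≢0 (D * c)
    c≢0 : ℕ.NonZero c
    c≢0 = ℕ.m*n≢0⇒n≢0 D
    D≢0 : ℕ.NonZero D
    D≢0 = ℕ.m*n≢0⇒m≢0 D
    N≢0 : ℕ.NonZero N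
    N≢0 = ℕ.m*n≢0 (suc (k + k)) D
    cN≢0 : ℕ.NonZero (c * N)
    cN≢0 = ℕ.m*n≢0 c N
    Dt≢0 : ℕ.NonZero (D * t)
    Dt≢0 = ℕ.m*n≢0 D t

  regroup : ℕ→ℚ (c * N) ℚ.* (ℕ→ℚ n ℚ.* r) ≡ ℕ→ℚ (n * c) ℚ.* s
  regroup = begin-equality
    ℕ→ℚ (c * N) ℚ.* (ℕ→ℚ n ℚ.* r)     ≡⟨ ℚ.*-assoc (ℕ→ℚ (c * N)) (ℕ→ℚ n) r ⟨
    ℕ→ℚ (c * N) ℚ.* ℕ→ℚ n ℚ.* r       ≡⟨ cong (ℚ._* r) (ℕ→ℚ-* (c * N) n) ⟨
    ℕ→ℚ (c * N * n) ℚ.* r             ≡⟨ cong (λ x → ℕ→ℚ x ℚ.* r) (commute c N n) ⟩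
    ℕ→ℚ (n * c * N) ℚ.* r             ≡⟨ cong (ℚ._* r) (ℕ→ℚ-* (n * c) N) ⟩
    ℕ→ℚ (n * c) ℚ.* ℕ→ℚ N ℚ.* r       ≡⟨ ℚ.*-assoc (ℕ→ℚ (n * c)) (ℕ→ℚ N) r ⟩
    ℕ→ℚ (n * c) ℚ.* (ℕ→ℚ N ℚ.* r)     ≡⟨ cong (ℕ→ℚ (n * c) ℚ.*_) Nr≡s ⟩
    ℕ→ℚ (n * c) ℚ.* s                 ∎
    where
    commute : ∀ c N n → c * N * n ≡ n * c * N
    commute = solve-∀

  split : ℕ→ℚ (suc k * c₁ + k * c) ℚ.* s ≡
          ℕ→ℚ (suc k) ℚ.* (ℕ→ℚ c₁ ℚ.* s) ℚ.+ ℕ→ℚ (k * c) ℚ.* s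
  split = begin-equality
    ℕ→ℚ (suc k * c₁ + k * c) ℚ.* s                            ≡⟨ cong (ℚ._* s) (ℕ→ℚ-+ (suc k * c₁) (k * c)) ⟩
    (ℕ→ℚ (suc k * c₁) ℚ.+ ℕ→ℚ (k * c)) ℚ.* s                  ≡⟨ ℚ.*-distribʳ-+ s (ℕ→ℚ (suc k * c₁)) (ℕ→ℚ (k * c)) ⟩
    ℕ→ℚ (suc k * c₁) ℚ.* s ℚ.+ ℕ→ℚ (k * c) ℚ.* s              ≡⟨ cong (λ x → x ℚ.* s ℚ.+ ℕ→ℚ (k * c) ℚ.* s) (ℕ→ℚ-* (suc k) c₁) ⟩
    ℕ→ℚ (suc k) ℚ.* ℕ→ℚ c₁ ℚ.* s ℚ.+ ℕ→ℚ (k * c) ℚ.* s        ≡⟨ cong (ℚ._+ ℕ→ℚ (k * c) ℚ.* s) (ℚ.*-assoc (ℕ→ℚ (suc k)) (ℕ→ℚ c₁) s) ⟩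
    ℕ→ℚ (suc k) ℚ.* (ℕ→ℚ c₁ ℚ.* s) ℚ.+ ℕ→ℚ (k * c) ℚ.* s      ∎

  count : suc k * L + k * c ≤ c * N * t
  count = R.begin
    -- The summand k·c is absorbed using D·t ≥ 1, so the factor 2k+1 arises as (k+1) + k.
    suc k * L + k * c                        R.≤⟨ ℕ.+-mono-≤ (ℕ.*-monoʳ-≤ (suc k) L≤Dct) (ℕ.m≤m*n (k * c) (D * t)) ⟩
    suc k * (D * c * t) + k * c * (D * t)    R.≡⟨ collect k c D t ⟩
    c * N * t                                R.∎
    where
    module R = ℕ.≤-Reasoning
    collect : ∀ k c D t → suc k * (D * c * t) + k * c * (D * t) ≡ c * (suc (k + k) * D) * t
    collect = solve-∀

-- Starting order and convexity on a level.

-- On level i, S starts no later than T; stated through points because a set of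
-- 𝒞 P need not have a leftmost point on a level.
Starts : Fin d → (S T : Pred (Point d) 0ℓ) → Set₁
Starts i S T = ∀ x → (x , i) ∈ T → ∃[ y ] y ≤ᴿ x × (y , i) ∈ S

Starts-trans : ∀ i (S T U : Pred (Point d) 0ℓ) →
  Starts i S T → Starts i T U → Starts i S U
Starts-trans i S T U st tu x x∈U =
  let y , y≤x , y∈T = tu x x∈U ; z , z≤y , z∈S = st y y∈T in z , (λ r → y≤x (z≤y r)) , z∈S

-- Since `q` is in `T`, the set `S` has a point at or to the left of `q`. Thus `q` lies between two
-- points of the interval that cuts out `S`, and convexity applies.
extend-left : ∀ {P S T : Pred (Point d) 0ℓ} {p q : Point d} → S ∈ 𝒞 P → level q ≡ level p →
  proj₁ q ≤ᴿ proj₁ p → p ∈ S → q ∈ T → q ∈ P → Starts (level p) S T → q ∈ S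
extend-left {p = x , i} {y , _} (I , S⊆ , ⊆S) refl y≤x p∈S q∈T q∈P st =
  let z , z≤y , z∈S = st y q∈T
      z∈I = proj₁ (S⊆ z∈S)
      x∈I = proj₁ (S⊆ p∈S)
  in ⊆S (Interval.convex I i {z} {y} {x} z∈I x∈I z≤y y≤x , q∈P)

length-cartesianProduct : ∀ {a b} {A : Set a} {B : Set b} (xs : List A) (ys : List B) →
  length (cartesianProduct xs ys) ≡ length xs * length ys
length-cartesianProduct []       ys = refl
length-cartesianProduct (x ∷ xs) ys = trans (List.length-++ (map (x ,_) ys))
  (cong₂ _+_ (List.length-map (x ,_) ys) (length-cartesianProduct xs ys))

-- `later a` is kept inside `G - spare` because this remainder is what families with equal keys
-- share. That it starts last on its level is recorded only relative to the spare set.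
record Spared {d n} (k : ℕ) (P : Pred (Point d) 0ℓ) (F : Fin n → Pred (Point d) 0ℓ)
              (G : Subset n) : Set₁ where
  field
    size            : ∣ G ∣ ≡ suc k
    point           : Fin k → Point d
    point∈P         : ∀ a → point a ∈ P
    point∈F         : ∀ a j → j Sub.∈ G → point a ∈ F j
    level-injective : Injective _≡_ _≡_ (level ∘ point)
    spare           : Fin n
    spare∈G         : spare Sub.∈ G
    later           : Fin k → Fin n
    later∈          : ∀ a → later a Sub.∈ G - spare
    starts          : ∀ a → Starts (level (point a)) (F spare) (F (later a))

-- Totality of the orders by excluded middle.

module Classical (em : ExcludedMiddle (lsuc 0ℓ)) where

  em₀ : (A : Set) → Dec A
  em₀ A = Dec.map′ lower lift (em {Lift _ A})

  ≤-total : Total _≤ᴿ_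
  ≤-total x y with em₀ (∃[ q ] q ∈ Lower x × q ∉ Lower y)
  ... | yes (q , q∈x , q∉y) = inj₂ λ p∈y → down x (∈∧∉⇒< y p∈y q∉y) q∈x
  ... | no  x≯y             = inj₁ λ {q} q∈x → decidable-stable (em₀ _) λ q∉y → x≯y (q , q∈x , q∉y)

  -- Either one point of `S` is at or before all of `T`, or each point of `S` has a point of `T` at
  -- or before it.
  Starts-total : ∀ {i} → Total (Starts {d} i)
  Starts-total {i = i} S T with em {∃[ y ] (y , i) ∈ S × ∀ x → (x , i) ∈ T → y ≤ᴿ x}
  ... | yes (y , y∈S , y≤T) = inj₁ λ x x∈T → y , y≤T x x∈T , y∈S
  ... | no  none            = inj₂ λ y y∈S → decidable-stable (em {∃[ x ] x ≤ᴿ y × (x , i) ∈ T}) λ T>y →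
    none (y , y∈S , λ x x∈T → case ≤-total y x of λ
      { (inj₁ y≤x) → y≤x ; (inj₂ x≤y) → ⊥-elim (T>y (x , x≤y , x∈T)) })

-- Intersecting families from a common key.

module Fibres (em : ExcludedMiddle (lsuc 0ℓ)) {d n} (k : ℕ)
    (P : Pred (Point d) 0ℓ) (F : Fin n → Pred (Point d) 0ℓ) where

  open Classical em

  W : Set₁
  W = ∃ (Spared k P F)

  open module Sp (w : W) = Spared (proj₂ w)

  -- `Fin (d ^ k)` codes the level assignments `Fin k → Fin d`, which makes keys enumerable with
  -- decidable equality without function extensionality.
  Key : Set
  Key = Fin (d ^ k) × Subset n

  key : W → Key
  key w = funToFin (level ∘ point w) , proj₁ w - spare w

  _≟ₖ_ : DecidableEquality Key
  _≟ₖ_ = ≡-dec Fin._≟_ (Vec.≡-dec Bool._≟_)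

  keys : List Key
  keys = cartesianProduct (allFin (d ^ k)) (subsetsOfSize n k)

  length-keys : length keys ≡ d ^ k * (n C k)
  length-keys = trans (length-cartesianProduct (allFin (d ^ k)) (subsetsOfSize n k))
    (cong₂ _*_ (List.length-tabulate {n = d ^ k} id) (length-subsetsOfSize n k))

  key∈keys : ∀ w → key w ∈ₗ keys
  key∈keys w = Membership.∈-cartesianProduct⁺ (Membership.∈-allFin _)
    (∈-subsetsOfSize k _ (∣p-x∣≡k (spare∈G w) (size w)))

  key≡⇒level≡ : ∀ v w → key v ≡ key w → ∀ a → level (point v a) ≡ level (point w a)
  key≡⇒level≡ v w eq a = begin
    level (point v a)                           ≡⟨ Fin.finToFun-funToFin (level ∘ point v) a ⟨
    finToFun (funToFin (level ∘ point v)) a     ≡⟨ cong (λ f → finToFun f a) (,-injectiveˡ eq) ⟩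
    finToFun (funToFin (level ∘ point w)) a     ≡⟨ Fin.finToFun-funToFin (level ∘ point w) a ⟩
    level (point w a)                           ∎
    where open ≡-Reasoning

  -- Equal keys make `later w a` an index in the set of `v`, so `point v a` lies in `F (later w a)`
  -- and not before the start of the spare set of `w`; `point w a` bounds it on the right.
  leftmost∈spare : (∀ j → F j ∈ 𝒞 P) → ∀ v w → key v ≡ key w → ∀ a →
    proj₁ (point v a) ≤ᴿ proj₁ (point w a) → point v a ∈ F (spare w)
  leftmost∈spare F∈𝒞 v w eq a v≤w = extend-left {T = F (later w a)} {p = point w a} {point v a}
    (F∈𝒞 (spare w)) (key≡⇒level≡ v w eq a) v≤w
    (point∈F w a (spare w) (spare∈G w))
    (point∈F v a (later w a) (Subₚ.p─q⊆p (proj₁ v) Sub.⁅ spare v ⁆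
      (subst (later w a Sub.∈_) (sym (,-injectiveʳ eq)) (later∈ w a))))
    (point∈P v a) (starts w a)

  -- The key fixes the remainder `G - spare`, and putting the spare index back recovers `G`; hence
  -- different sets have different spares.
  spares-unique : ∀ {κ} {ws : List W} → All (λ w → key w ≡ κ) ws →
    AllPairs (_≢_ on proj₁) ws → Unique (map spare ws)
  spares-unique []         []           = []
  spares-unique {ws = w ∷ _} (eq ∷ eqs) (w≢ws ∷ ws!) = All.map⁺ (All.zipWith
    (λ {v} (eq′ , w≢v) spare≡ → w≢v (same w v (trans eq (sym eq′)) spare≡)) (eqs , w≢ws))
    ∷ spares-unique eqs ws!
    where
    same : ∀ w v → key w ≡ key v → spare w ≡ spare v → proj₁ w ≡ proj₁ v
    same w v eq spare≡ = p-x-injective (spare∈G w) (subst (Sub._∈ proj₁ v) (sym spare≡) (spare∈G v))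
      (trans (,-injectiveʳ eq) (cong (proj₁ v -_) (sym spare≡)))

  lastStarter : ∀ i (G : Subset n) → Sub.Nonempty G →
    ∃[ c ] c Sub.∈ G × ∀ j → j Sub.∈ G → Starts i (F j) (F c)
  lastStarter i G (j₀ , j₀∈G) = c , All.lookup members c∈ ,
    -- `j₀` heads the list to make it nonempty and recurs in `rest`, so `there` reaches every member
    -- of `G`.
    λ j j∈G → All.lookup latest (there (Membership.∈-filter⁺ (Subₚ._∈? G) (Membership.∈-allFin j) j∈G))
    where
    rest = filter (Subₚ._∈? G) (allFin n)
    R = λ j c → Starts i (F j) (F c)
    found = greatest {R = R} (λ j c → Starts-total (F j) (F c))
      (λ {j} {l} {m} → Starts-trans i (F j) (F l) (F m)) j₀ rest
    c = proj₁ found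
    c∈ = proj₁ (proj₂ found)
    latest = proj₂ (proj₂ found)
    members : All (Sub._∈ G) (j₀ ∷ rest)
    members = j₀∈G ∷ All.all-filter (Subₚ._∈? G) (allFin n)

  spared : ∀ {G} → ∣ G ∣ ≡ suc k × Intersecting k P F G → Spared k P F G
  spared {G} (size , p , p∈P , p∈F , inj) = record
    { size = size ; point = p ; point∈P = p∈P ; point∈F = p∈F ; level-injective = inj
    ; spare = b ; spare∈G = b∈G
    ; later = laters
    ; later∈ = λ a → Subₚ.x∈p∧x≢y⇒x∈p-y (proj₁ (proj₂ (last a))) (later≢b a)
    ; starts = λ a → proj₂ (proj₂ (last a)) b b∈G
    }
    where
    k<∣G∣ = ℕ.≤-reflexive (sym size)
    nonempty : Sub.Nonempty G
    nonempty = let x , x∈G , _ = outside-image {k = 0} G (λ ()) (ℕ.≤-trans (s≤s z≤n) k<∣G∣) in x , x∈G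
    last = λ a → lastStarter (level (p a)) G nonempty
    laters = λ a → proj₁ (last a)
    -- There are at most k chosen last starters, one per point, among k + 1 members.
    outsider = outside-image G laters k<∣G∣
    b = proj₁ outsider
    b∈G = proj₁ (proj₂ outsider)
    later≢b = proj₂ (proj₂ outsider)

  fibre-intersects : (∀ j → F j ∈ 𝒞 P) → ∀ {κ} (w : W) ws →
    All (λ v → key v ≡ κ) (w ∷ ws) → AllPairs (_≢_ on proj₁) (w ∷ ws) →
    ∃[ G ] Intersecting k P F G × length (w ∷ ws) ≤ ∣ G ∣
  fibre-intersects F∈𝒞 w ws keys≡ distinct = G , (p , p∈P , (λ a j j∈G → ∈G⁻ j∈G a) , inj) ,
    subst (_≤ ∣ G ∣) (List.length-map spare (w ∷ ws))
      (length≤∣p∣ G (spares-unique keys≡ distinct)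
        (All.map⁺ (All.tabulate λ {v} v∈ → ∈G⁺ λ a →
          leftmost∈spare F∈𝒞 (m a) v (same-key (m a) v (m∈ a) v∈) a
            (All.lookup (proj₂ (proj₂ (leftmost a))) v∈))))
    where
    -- Reversed, so that the greatest element is the leftmost point.
    R = λ a u v → proj₁ (point v a) ≤ᴿ proj₁ (point u a)
    leftmost = λ a → greatest {R = R a} (λ u v → ≤-total (proj₁ (point v a)) (proj₁ (point u a)))
      (λ v≤u w≤v q → v≤u (w≤v q)) w ws
    m = λ a → proj₁ (leftmost a)
    m∈ = λ a → proj₁ (proj₂ (leftmost a))
    p : Fin k → Point d
    p a = point (m a) a
    p∈P = λ a → point∈P (m a) a
    same-key : ∀ u v → u ∈ₗ (w ∷ ws) → v ∈ₗ (w ∷ ws) → key u ≡ key v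
    same-key u v u∈ v∈ = trans (All.lookup keys≡ u∈) (sym (All.lookup keys≡ v∈))
    level-p : ∀ a → level (p a) ≡ level (point w a)
    level-p a = key≡⇒level≡ (m a) w (same-key (m a) w (m∈ a) (here refl)) a
    -- The points of `p` may come from different members of the fibre; the common key gives them the
    -- levels of the points of `w`.
    inj : Injective _≡_ _≡_ (level ∘ p)
    inj {a} {b} eq = level-injective w (trans (sym (level-p a)) (trans eq (level-p b)))
    p∈? = λ j → em₀ (∀ a → p a ∈ F j)
    -- All indices whose sets contain the chosen points: intersecting is then immediate, and the
    -- distinct spares bound the size from below.
    G = tabulate (does ∘ p∈?)
    ∈G⁺ : ∀ {j} → (∀ a → p a ∈ F j) → j Sub.∈ G
    ∈G⁺ {j} p∈Fj = Vec.lookup⇒[]= j G (trans (Vec.lookup∘tabulate (does ∘ p∈?) j) (dec-true (p∈? j) p∈Fj))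
    ∈G⁻ : ∀ {j} → j Sub.∈ G → ∀ a → p a ∈ F j
    ∈G⁻ {j} j∈G with p∈? j in eq
    ... | yes p∈Fj = p∈Fj
    ... | no  _    = contradiction
      (trans (sym (cong does eq)) (trans (sym (Vec.lookup∘tabulate (does ∘ p∈?) j)) (Vec.[]=⇒lookup j∈G))) λ ()

  largeIntersecting : (∀ j → F j ∈ 𝒞 P) → ∀ Gs → Unique Gs →
    All (λ G → ∣ G ∣ ≡ suc k × Intersecting k P F G) Gs → 0 < length Gs →
    ∃[ G ] Intersecting k P F G × length Gs ≤ d ^ k * (n C k) * ∣ G ∣
  largeIntersecting F∈𝒞 Gs Gs! Gs-int Gs≢[] = result fibre₀ (All.all-filter (λ w → key w ≟ₖ κ) ws) fibre₀! bound
    where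
    -- Dropping the witnesses returns `Gs`, which carries its length and uniqueness over to `ws`.
    toList-proj₁ : ∀ {Gs} (qs : All (Spared k P F) Gs) → map proj₁ (All.toList qs) ≡ Gs
    toList-proj₁ []       = refl
    toList-proj₁ (_ ∷ qs) = cong (_ ∷_) (toList-proj₁ qs)
    qs = All.map spared Gs-int
    ws = All.toList qs
    length-ws : length ws ≡ length Gs
    length-ws = trans (sym (List.length-map proj₁ ws)) (cong length (toList-proj₁ qs))
    pigeon = pigeonhole _≟ₖ_ key keys ws (subst (0 <_) (sym length-ws) Gs≢[])
      (All.tabulate λ {w} _ → key∈keys w)
    κ = proj₁ pigeon
    fibre₀ = fibre _≟ₖ_ key κ ws
    fibre₀! : AllPairs (_≢_ on proj₁) fibre₀
    fibre₀! = AllPairs.filter⁺ (λ w → key w ≟ₖ κ) (AllPairs.map⁻ (subst Unique (sym (toList-proj₁ qs)) Gs!))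
    bound : length Gs ≤ d ^ k * (n C k) * length fibre₀
    bound = subst (_≤ d ^ k * (n C k) * length fibre₀) length-ws (subst (λ m → length ws ≤ m * length fibre₀)
      length-keys (proj₂ pigeon))
    result : ∀ vs → All (λ v → key v ≡ κ) vs → AllPairs (_≢_ on proj₁) vs →
      length Gs ≤ d ^ k * (n C k) * length vs →
      ∃[ G ] Intersecting k P F G × length Gs ≤ d ^ k * (n C k) * ∣ G ∣
    -- An empty fibre would force `length Gs` to be zero.
    result []       _  _   le = contradiction
      (subst (length Gs ℕ.≤_) (ℕ.*-zeroʳ (d ^ k * (n C k))) le) (ℕ.<⇒≱ Gs≢[])
    result (v ∷ vs) eq vs! le =
      let G , int , vs≤G = fibre-intersects F∈𝒞 v vs eq vs!
      in G , int , ℕ.≤-trans le (ℕ.*-monoʳ-≤ (d ^ k * (n C k)) vs≤G)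

-- The fractional Helly property at k + 1 and the least such number.

fractionalHelly : ExcludedMiddle (lsuc 0ℓ) → ∀ d .{{_ : ℕ.NonZero d}} (P : Pred (Point d) 0ℓ) k →
  FractionalHelly k P (suc k)
fractionalHelly em d P k = _÷ᵤ N , (λ (α≤β , β≤α) → α≤β , β≤α) , helly
  where
  -- The factor 2k+1 comes from `density-transfer`, and d ^ k counts the level assignments among the
  -- keys.
  N = suc (k + k) * d ^ k
  instance
    d^k≢0 : ℕ.NonZero (d ^ k)
    d^k≢0 = ℕ.m^n≢0 d k
    N≢0 : ℕ.NonZero N
    N≢0 = ℕ.m*n≢0 (suc (k + k)) (d ^ k)
  helly : ∀ α n (F : Fin n → Pred (Point d) 0ℓ) → (∀ j → F j ∈ 𝒞 P) → _ → suc k ≤ n →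
    ManyIntersecting k P F (suc k) ((n C suc k) • proj₁ α) →
    ∃[ G ] Intersecting k P F G × n • proj₁ (α ÷ᵤ N) ≤ᴿ fromℕ ∣ G ∣
  helly (x , (p , p∈x , p≮0) , (u , u<1 , u∉x)) n F F∈𝒞 _ k<n (Gs , Gs! , Gs-int , cx≤) =
    G , int , λ (r , Nr∈x , q<nr) → ℚ.<-≤-trans q<nr
      (density-transfer n k (d ^ k) ∣ G ∣ (length Gs)
        (ℚ.<⇒≤ (ℚ.<-trans (∈∧∉⇒< x Nr∈x u∉x) u<1)) (scaled≤ Nr∈x) Gs≢[] bound {r} refl)
    where
    c = n C suc k
    scaled≤ : ∀ {s} → s ∈ Lower x → ℕ→ℚ c ℚ.* s ℚ.≤ ℕ→ℚ (length Gs)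
    -- If the length were below c·s, it would lie in the lower cut of `c • x`, hence below itself.
    scaled≤ s∈x = ℚ.≮⇒≥ λ L<cs → ℚ.<-irrefl refl (cx≤ (_ , s∈x , L<cs))
    instance
      c≢0 : ℕ.NonZero c
      c≢0 = ℕ.>-nonZero (nCk>0 k<n)
    Gs≢[] : 0 < length Gs
    Gs≢[] = ℕ.n≢0⇒n>0 λ L≡0 →
      -- `p` may be zero; openness of the cut gives a positive `s`, and C(n,k+1) is positive because
      -- k + 1 ≤ n.
      let s , p<s , s∈x = open′ x p∈x
          0<s  = ℚ.≤-<-trans (ℚ.≮⇒≥ p≮0) p<s
          0<cs = subst (ℚ._< ℕ→ℚ c ℚ.* s) (ℚ.*-zeroʳ (ℕ→ℚ c))
                   (ℚ.*-monoʳ-<-pos (ℕ→ℚ c) {{ℕ→ℚ-pos c}} 0<s)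
      in ℚ.<-irrefl refl (ℚ.<-≤-trans 0<cs (subst (λ L → _ ℚ.≤ ℕ→ℚ L) L≡0 (scaled≤ s∈x)))
    large = Fibres.largeIntersecting em k P F F∈𝒞 Gs Gs! Gs-int Gs≢[]
    G = proj₁ large
    int = proj₁ (proj₂ large)
    bound = proj₂ (proj₂ large)

-- Strong induction: excluded middle either finds a smaller number satisfying `Q` or shows `m` to be
-- minimal.
least : ExcludedMiddle (lsuc 0ℓ) → (Q : ℕ → Set₁) → ∀ m → Q m →
  ∃[ h ] (Q h × (∀ j → Q j → h ≤ j)) × h ≤ m
least em Q = <-rec _ λ m rec Qm → step m rec Qm
  where
  step : ∀ m → (∀ {j} → j < m → Q j → ∃[ h ] (Q h × (∀ i → Q i → h ≤ i)) × h ≤ j) →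
    Q m → ∃[ h ] (Q h × (∀ j → Q j → h ≤ j)) × h ≤ m
  step m rec Qm with em {∃[ j ] j < m × Q j}
  ... | yes (j , j<m , Qj) = let h , min , h≤j = rec j<m Qj in h , min , ℕ.≤-trans h≤j (ℕ.<⇒≤ j<m)
  ... | no  none           = m , (Qm , λ j Qj → ℕ.≮⇒≥ λ j<m → none (j , j<m , Qj)) , ℕ.≤-refl

theorem8 : ExcludedMiddle (lsuc 0ℓ) →
    ∀ (d : ℕ) → 1 ≤ d →
    ∀ (P : Pred (Point d) 0ℓ) → P Respects _≈ₚ_ →
    ∀ (k : ℕ) → 1 ≤ k → k ≤ d →
    ∃[ h ] IsFractionalHellyNumber k P h × h ≤ 2 * d ∸ k + 1
theorem8 em d 1≤d P _ k _ k≤d =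
  let h , isNumber , h≤1+k = least em (FractionalHelly k P) (suc k) (fractionalHelly em d {{ℕ.>-nonZero 1≤d}} P k)
  in h , isNumber , ℕ.≤-trans h≤1+k 1+k≤
  where
  open ℕ.≤-Reasoning
  1+k≤ : suc k ≤ 2 * d ∸ k + 1
  1+k≤ = begin
    suc k               ≡⟨ ℕ.+-comm k 1 ⟨
    -- From k ≤ d follows k + k ≤ 2d; the `d + 0` comes from unfolding `2 * d`.
    k + 1               ≤⟨ ℕ.+-monoˡ-≤ 1 (ℕ.m+n≤o⇒m≤o∸n k (ℕ.+-mono-≤ k≤d (ℕ.≤-trans k≤d (ℕ.m≤m+n d 0)))) ⟩
    2 * d ∸ k + 1       ∎
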